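{- Let $d\ge1$ and $h\ge 1$ be integers. The complete $d$-ary tree $T$ of height $h$ has a $(\leq 2d(d+1)^{h-1})$-subdivision $S$ with $\phi(S)\le 10$.
   Context: An anagram is a word of the form $WP$ where $W$ is a non-empty word and $P$ is a permutation of $W$. A vertex colouring of a graph is anagram-free if the sequence of colours along every path of the graph is not an anagram. $\phi(G)$ is the minimum number of colours in an anagram-free colouring of $G$. A subdivision of $G$ is obtained by replacing each edge $uv$ by a path with endpoints $u,v$; internal vertices are division vertices. A $(\le k)$-subdivision is a subdivision in which every edge receives at most $k$ division vertices. The complete $d$-ary tree of height $h$ is the rooted tree in which every non-leaf vertex has exactly $d$ children and every leaf is at distance $h$ from the root. -}

module Defs where

open import Level using (0ℓ)
open import Data.Nat using (ℕ; zero; suc; _≤_; _<_)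
open import Data.Fin using (Fin; toℕ)
open import Data.List using (List; []; _∷_; _++_; map; length)
open import Data.Product using (Σ; _×_; _,_; proj₁; proj₂)
open import Data.Sum using (_⊎_; inj₁; inj₂)
open import Relation.Binary.PropositionalEquality using (_≡_; _≢_)
open import Relation.Nullary using (¬_)
open import Data.List.Relation.Unary.Unique.Propositional using (Unique)
open import Data.List.Relation.Unary.Linked using (Linked)
open import Data.List.Relation.Binary.Permutation.Propositional using (_↭_)

-- A (simple, undirected) graph, given by a vertex type and an adjacency
-- relation; adjacency is symmetrised when paths are formed.
record Graph : Set₁ where
  field
    V   : Set
    Adj : V → V → Set

open Graph public

SAdj : (G : Graph) → V G → V G → Set
SAdj G x y = Adj G x y ⊎ Adj G y x

IsPath : (G : Graph) → List (V G) → Set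
IsPath G p = Unique p × Linked (SAdj G) p

IsAnagram : {A : Set} → List A → Set
IsAnagram {A} w = Σ (List A) λ W → Σ (List A) λ P →
  (W ≢ []) × (P ↭ W) × (w ≡ W ++ P)

AnagramFree : (G : Graph) {C : Set} → (V G → C) → Set
AnagramFree G c = ∀ (p : List (V G)) → IsPath G p → ¬ IsAnagram (map c p)

φ≤ : Graph → ℕ → Set
φ≤ G k = Σ (V G → Fin k) λ c → AnagramFree G c

record EdgeGraph : Set₁ where
  field
    Vert : Set
    Edge : Set
    src  : Edge → Vert
    tgt  : Edge → Vert

open EdgeGraph public

toGraph : EdgeGraph → Graph
toGraph G = record { V = Vert G ; Adj = λ x y → Σ (Edge G) λ e → (src G e ≡ x) × (tgt G e ≡ y) }

-- Subdivision of G where edge e receives s e division vertices: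
-- edge e = uv is replaced by the path u, (e,0), (e,1), …, (e,s e - 1), v.
SubVert : (G : EdgeGraph) → (Edge G → ℕ) → Set
SubVert G s = Vert G ⊎ Σ (Edge G) λ e → Fin (s e)

data SubAdj (G : EdgeGraph) (s : Edge G → ℕ) : SubVert G s → SubVert G s → Set where
  direct : (e : Edge G) → s e ≡ 0 → SubAdj G s (inj₁ (src G e)) (inj₁ (tgt G e))
  first  : (e : Edge G) (i : Fin (s e)) → toℕ i ≡ 0 →
           SubAdj G s (inj₁ (src G e)) (inj₂ (e , i))
  middle : (e : Edge G) (i j : Fin (s e)) → toℕ j ≡ suc (toℕ i) →
           SubAdj G s (inj₂ (e , i)) (inj₂ (e , j))
  last   : (e : Edge G) (i : Fin (s e)) → suc (toℕ i) ≡ s e →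
           SubAdj G s (inj₂ (e , i)) (inj₁ (tgt G e))

Subdivision : (G : EdgeGraph) → (Edge G → ℕ) → Graph
Subdivision G s = record { V = SubVert G s ; Adj = SubAdj G s }

-- Complete d-ary tree of height h.  Vertices: words over Fin d of
-- length ≤ h (address from the root, most recent choice at the head);
-- edges: a vertex l of depth < h joined to its child i ∷ l.

TreeVert : ℕ → ℕ → Set
TreeVert d h = Σ (List (Fin d)) λ l → length l ≤ h

TreeEdge : ℕ → ℕ → Set
TreeEdge d h = (Σ (List (Fin d)) λ l → length l < h) × Fin d

CompleteTree : ℕ → ℕ → EdgeGraph
CompleteTree d h = record
  { Vert = TreeVert d h
  ; Edge = TreeEdge d h
  ; src  = λ { ((l , p) , i) → (l , Data.Nat.Properties.<⇒≤ p) }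
  ; tgt  = λ { ((l , p) , i) → (i ∷ l , p) }
  }
  where import Data.Nat.Properties

module Submission where

-- The letters met on the way down from the root spell an abelian-square-free
-- word over six letters, so a path inside one root-to-leaf path is not an
-- anagram. Three further colours handle the paths with an apex. Internal tree
-- vertices are coloured ⋆. The i-th edge (i = 1, …, d) below a vertex at height
-- r + 2 above the leaves gets 4n division vertices, n = i (d+1)^r, in which
-- letters alternate with marks, first n marks ♭ and then n marks ♯; leaf edges
-- are not subdivided. The marks below an edge with parameter n number less
-- than (d+1)^r of each kind. Let a path climb through edge i to its apex and
-- descend through edge j, its midpoint being on the descending leg. Counting ⋆
-- shows that it passes all of edge j, and counting ♭ that the midpoint comes
-- before the marks ♯ of edge j. So the climbing leg must supply those n_j marks
-- ♯ and contains all ♭ of edge i; counting ♭ again gives i < j, and then the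
-- climbing leg has too few ♯.
--
-- The abelian-square-free word is the fixed point of a 9-uniform morphism.
-- For an abelian square in it, the offsets of its two ends and its middle
-- within their blocks are equal, and it can be shifted to block boundaries,
-- where it descends to a shorter abelian square of the same word.

open import Defs
open import Data.Nat
open import Data.Nat.Properties
open import Data.Nat.DivMod
open import Data.Nat.Divisibility using (n∣m*n)
open import Data.Nat.ListAction using (sum)
open import Data.Nat.ListAction.Properties using (sum-↭)
open import Data.Nat.Tactic.RingSolver using (solve-∀)
open import Data.Bool using (Bool; true; false; not; if_then_else_)
open import Data.Empty using (⊥)
open import Data.Fin as Fin using (Fin; toℕ)
open import Data.Fin.Patterns
open import Data.Fin.Properties as Fin using (all?; toℕ<n; toℕ-injective)
open import Data.List using (List; []; _∷_; _++_; map; length)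
open import Data.List.Properties using (∷-injectiveˡ; ∷-injectiveʳ; length-++; map-++; map-∘; map-cong)
open import Data.List.Relation.Unary.All using (All; _∷_)
open import Data.List.Relation.Unary.AllPairs using (_∷_)
open import Data.List.Relation.Unary.Linked using (_∷_)
open import Data.List.Relation.Unary.Unique.Propositional using (Unique)
open import Data.List.Relation.Binary.Permutation.Propositional using (_↭_; ↭-sym)
open import Data.List.Relation.Binary.Permutation.Propositional.Properties using (map⁺; ↭-length)
open import Data.Product using (Σ; ∃; ∃₂; _×_; _,_; proj₁; proj₂)
open import Data.Sum as Sum using (_⊎_; inj₁; inj₂; [_,_]′)
open import Data.Sum.Properties using (inj₁-injective)
open import Relation.Nullary
open import Relation.Nullary.Decidable using (from-yes; _×-dec_; _⊎-dec_; _→-dec_)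
open import Relation.Binary.Construct.Closure.ReflexiveTransitive using (Star; ε; _◅_; _◅◅_)
open import Relation.Binary.PropositionalEquality

-- An abelian-square-free word over six letters

δ : ∀ {n} → Fin n → Fin n → ℕ
δ a b = if does (a Fin.≟ b) then 1 else 0

count : ∀ {k} → (ℕ → Fin k) → Fin k → ℕ → ℕ
count f d zero    = 0
count f d (suc n) = count f d n + δ (f n) d

nth : ∀ {A : Set} → A → List A → ℕ → A
nth z []       _       = z
nth z (x ∷ xs) zero    = x
nth z (x ∷ xs) (suc i) = nth z xs i

-- Found by computer search. Letter a occurs four times in block a and every
-- other letter once, so modulo 3 the number of occurrences of a letter before
-- a position depends only on the number and the content of its own block.
block : Fin 6 → List (Fin 6)
block 0F = 5F ∷ 0F ∷ 4F ∷ 0F ∷ 2F ∷ 0F ∷ 1F ∷ 0F ∷ 3F ∷ []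
block 1F = 2F ∷ 1F ∷ 3F ∷ 1F ∷ 0F ∷ 1F ∷ 5F ∷ 1F ∷ 4F ∷ []
block 2F = 2F ∷ 1F ∷ 0F ∷ 2F ∷ 4F ∷ 2F ∷ 5F ∷ 2F ∷ 3F ∷ []
block 3F = 5F ∷ 3F ∷ 1F ∷ 3F ∷ 4F ∷ 3F ∷ 0F ∷ 2F ∷ 3F ∷ []
block 4F = 2F ∷ 5F ∷ 4F ∷ 3F ∷ 4F ∷ 0F ∷ 4F ∷ 1F ∷ 4F ∷ []
block 5F = 5F ∷ 0F ∷ 5F ∷ 2F ∷ 5F ∷ 3F ∷ 5F ∷ 1F ∷ 4F ∷ []

-- The default `0F` is never read: positions inside a block stay below 9.
image : Fin 6 → ℕ → Fin 6
image a = nth 0F (block a)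

pre : Fin 6 → Fin 9 → Fin 6 → ℕ
pre a i d = count (image a) d (toℕ i)

-- Nine times the balance of the letter d minus the balance of the lengths,
-- taken modulo 27 so that everything before the three blocks drops out.
Congruent : (i j k : Fin 9) (a b c : Fin 6) → Fin 6 → Set
Congruent i j k a b c d =
  (toℕ i + toℕ k + 18 * pre b j d) % 27 ≡ (2 * toℕ j + 9 * (pre a i d + pre c k d)) % 27

-- The alternatives say that the cut points can be moved to block boundaries: in the first the block
-- prefixes before them balance, in the second the suffixes after them, where the suffix of block a
-- holds `1 + 3 * δ a d` minus `pre a i d` letters d.
Aligned : (i j k : Fin 9) (a b c : Fin 6) → Set
Aligned i j k a b c = (i ≡ j × j ≡ k) ×
  ((∀ d → pre a i d + pre c k d ≡ 2 * pre b j d) ⊎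
   (∀ d → pre a i d + pre c k d + 6 * δ b d ≡ 2 * pre b j d + 3 * (δ a d + δ c d)))

abstract
  -- A finite check by evaluation. The condition on the offsets precedes the quantifiers over
  -- letters, so most triples of offsets are discarded at once.
  congruent⇒aligned : ∀ i j k → (toℕ i + toℕ k) % 9 ≡ (2 * toℕ j) % 9 →
    ∀ a b c → (∀ d → Congruent i j k a b c d) → Aligned i j k a b c
  congruent⇒aligned = from-yes
    (all? λ i → all? λ j → all? λ k → (toℕ i + toℕ k) % 9 ≟ (2 * toℕ j) % 9 →-dec
    (all? λ a → all? λ b → all? λ c →
      (all? λ d → (toℕ i + toℕ k + 18 * pre b j d) % 27 ≟ (2 * toℕ j + 9 * (pre a i d + pre c k d)) % 27) →-dec
      ((i Fin.≟ j ×-dec j Fin.≟ k) ×-dec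
       ((all? λ d → pre a i d + pre c k d ≟ 2 * pre b j d) ⊎-dec
        (all? λ d → pre a i d + pre c k d + 6 * δ b d ≟ 2 * pre b j d + 3 * (δ a d + δ c d))))))

  block-parikh : ∀ a d → count (image a) d 9 ≡ 1 + 3 * δ a d
  block-parikh = from-yes (all? λ a → all? λ d → count (image a) d 9 ≟ 1 + 3 * δ a d)

-- The first argument is fuel. The base value `5F` is the first letter of the fixed point:
-- `block 5F` begins with `5F`, so extra fuel changes nothing.
wordᶠ : ℕ → ℕ → Fin 6
wordᶠ zero    n = 5F
wordᶠ (suc k) n = image (wordᶠ k (n / 9)) (n % 9)

word : ℕ → Fin 6
word n = wordᶠ n n

n/9≤ : ∀ {n k} → n ≤ suc k → n / 9 ≤ k
n/9≤ {zero}  _ = z≤n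
n/9≤ {suc n} p = ≤-pred (≤-trans (m/n<m (suc n) 9 (s≤s (s≤s z≤n))) p)

wordᶠ-suc : ∀ k {n} → n ≤ k → wordᶠ (suc k) n ≡ wordᶠ k n
wordᶠ-suc zero    z≤n = refl
wordᶠ-suc (suc k) p = cong (λ a → image a _) (wordᶠ-suc k (n/9≤ p))

wordᶠ-+ : ∀ k n → wordᶠ (k + n) n ≡ word n
wordᶠ-+ zero    n = refl
wordᶠ-+ (suc k) n = trans (wordᶠ-suc (k + n) (m≤n+m n k)) (wordᶠ-+ k n)

wordᶠ≡word : ∀ {k n} → n ≤ k → wordᶠ k n ≡ word n
wordᶠ≡word {k} {n} p = subst (λ j → wordᶠ j n ≡ word n) (m∸n+n≡m p) (wordᶠ-+ (k ∸ n) n)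

word-div : ∀ n → word n ≡ image (word (n / 9)) (n % 9)
word-div n = trans (sym (wordᶠ-suc n ≤-refl)) (cong (λ a → image a (n % 9)) (wordᶠ≡word (m/n≤m n 9)))

word-block : ∀ q {i} → i < 9 → word (i + q * 9) ≡ image (word q) i
word-block q {i} i<9 = trans (word-div (i + q * 9)) (cong₂ (λ x y → image (word x) y) lemma₁ lemma₂)
  where
  lemma₂ : (i + q * 9) % 9 ≡ i
  lemma₂ = trans ([m+kn]%n≡m%n i q 9) (m<n⇒m%n≡m i<9)
  lemma₁ : (i + q * 9) / 9 ≡ q
  lemma₁ = trans (+-distrib-/-∣ʳ i (n∣m*n q)) (cong₂ _+_ (m<n⇒m/n≡0 i<9) (m*n/n≡m q 9))

count-+ : ∀ {k} (f : ℕ → Fin k) d m n → count f d (n + m) ≡ count f d m + count (λ i → f (i + m)) d n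
count-+ f d m zero    = sym (+-identityʳ _)
count-+ f d m (suc n) = trans (cong (_+ δ (f (n + m)) d) (count-+ f d m n)) (+-assoc (count f d m) _ _)

count-cong : ∀ {k} {f g : ℕ → Fin k} d n → (∀ {i} → i < n → f i ≡ g i) → count f d n ≡ count g d n
count-cong d zero    h = refl
count-cong d (suc n) h = cong₂ (λ c x → c + δ x d) (count-cong d n (λ p → h (m≤n⇒m≤1+n p))) (h ≤-refl)

occ : Fin 6 → ℕ → ℕ
occ = count word

occ-block : ∀ q {i} → i ≤ 9 → ∀ d → occ d (i + q * 9) ≡ occ d (q * 9) + count (image (word q)) d i
occ-block q {i} i≤9 d = trans (count-+ word d (q * 9) i)
  (cong (occ d (q * 9) +_) (count-cong d i (λ j<i → word-block q (<-≤-trans j<i i≤9))))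

-- By `block-parikh` every block contributes one letter d, and three more if it is the block of d.
occ-*9 : ∀ q d → occ d (q * 9) ≡ q + 3 * occ d q
occ-*9 zero    d = refl
occ-*9 (suc q) d = begin
  occ d (9 + q * 9)                             ≡⟨ occ-block q ≤-refl d ⟩
  occ d (q * 9) + count (image (word q)) d 9    ≡⟨ cong₂ _+_ (occ-*9 q d) (block-parikh (word q) d) ⟩
  q + 3 * occ d q + (1 + 3 * δ (word q) d)      ≡⟨ rearrange q (occ d q) (δ (word q) d) ⟩
  suc q + 3 * (occ d q + δ (word q) d)          ∎
  where
  open ≡-Reasoning
  rearrange : ∀ q f e → q + 3 * f + (1 + 3 * e) ≡ suc q + 3 * (f + e)
  rearrange = solve-∀

occ-expand : ∀ q (i : Fin 9) d → occ d (toℕ i + q * 9) ≡ q + 3 * occ d q + pre (word q) i d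
occ-expand q i d = trans (occ-block q (<⇒≤ (toℕ<n i)) d) (cong (_+ pre (word q) i d) (occ-*9 q d))


-- The factors of word at positions [m, n) and [n, o) are anagrams of each other.
Balanced : ℕ → ℕ → ℕ → Set
Balanced m n o = m + o ≡ 2 * n × (∀ d → occ d m + occ d o ≡ 2 * occ d n)

occ-suc-balanced : ∀ {p q r} → p + r ≡ 2 * q →
  (∀ d → occ d (suc p) + occ d (suc r) ≡ 2 * occ d (suc q)) → Balanced (suc p) (suc q) (suc r)
occ-suc-balanced {p} {q} {r} e h = trans (cong suc (+-suc p r)) (trans (cong (2 +_) e) (sym (*-suc 2 q))) , h

-- Descent of abelian squares to block boundaries

module _ (p q r : ℕ) (i j k : Fin 9) where

  private
    a = word p
    b = word q
    c = word r

  module _ (bal : Balanced (toℕ i + p * 9) (toℕ j + q * 9) (toℕ k + r * 9)) where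

    length-balance : toℕ i + p * 9 + (toℕ k + r * 9) ≡ 2 * (toℕ j + q * 9)
    length-balance = proj₁ bal

    count-balance : ∀ d → (p + 3 * occ d p + pre a i d) + (r + 3 * occ d r + pre c k d)
                 ≡ 2 * (q + 3 * occ d q + pre b j d)
    count-balance d = begin
      (p + 3 * occ d p + pre a i d) + (r + 3 * occ d r + pre c k d)
        ≡⟨ cong₂ _+_ (sym (occ-expand p i d)) (sym (occ-expand r k d)) ⟩
      occ d (toℕ i + p * 9) + occ d (toℕ k + r * 9)
        ≡⟨ proj₂ bal d ⟩
      2 * occ d (toℕ j + q * 9)
        ≡⟨ cong (2 *_) (occ-expand q j d) ⟩
      2 * (q + 3 * occ d q + pre b j d) ∎
      where open ≡-Reasoning

    lengths-mod : (toℕ i + toℕ k) % 9 ≡ (2 * toℕ j) % 9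
    lengths-mod = begin
      (toℕ i + toℕ k) % 9                     ≡⟨ [m+kn]%n≡m%n (toℕ i + toℕ k) (p + r) 9 ⟨
      (toℕ i + toℕ k + (p + r) * 9) % 9       ≡⟨ cong (_% 9) (lhs (toℕ i) (toℕ k) p r) ⟩
      (toℕ i + p * 9 + (toℕ k + r * 9)) % 9   ≡⟨ cong (_% 9) length-balance ⟩
      (2 * (toℕ j + q * 9)) % 9               ≡⟨ cong (_% 9) (rhs (toℕ j) q) ⟩
      (2 * toℕ j + (2 * q) * 9) % 9           ≡⟨ [m+kn]%n≡m%n (2 * toℕ j) (2 * q) 9 ⟩
      (2 * toℕ j) % 9                         ∎
      where
      open ≡-Reasoning
      lhs : ∀ i k p r → i + k + (p + r) * 9 ≡ i + p * 9 + (k + r * 9)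
      lhs = solve-∀
      rhs : ∀ j q → 2 * (j + q * 9) ≡ 2 * j + (2 * q) * 9
      rhs = solve-∀

    -- The length balance plus nine times the reversed count balance: both sides contain
    -- `9 * (p + r + 2 * q)`, which cancels, and the counts before the blocks get the coefficient
    -- 27.
    counts-mod : ∀ d → (toℕ i + toℕ k + 18 * pre b j d) % 27 ≡ (2 * toℕ j + 9 * (pre a i d + pre c k d)) % 27
    counts-mod d = begin
      L % 27                                ≡⟨ [m+kn]%n≡m%n L (2 * occ d q) 27 ⟨
      (L + 2 * occ d q * 27) % 27             ≡⟨ cong (_% 27) (+-cancelˡ-≡ (9 * (p + r + 2 * q)) _ _ cancelled) ⟩
      (R + (occ d p + occ d r) * 27) % 27       ≡⟨ [m+kn]%n≡m%n R (occ d p + occ d r) 27 ⟩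
      R % 27                                ∎
      where
      open ≡-Reasoning
      L = toℕ i + toℕ k + 18 * pre b j d
      R = 2 * toℕ j + 9 * (pre a i d + pre c k d)
      lhs : ∀ i k p q r f x → 9 * (p + r + 2 * q) + (i + k + 18 * x + 2 * f * 27)
          ≡ i + p * 9 + (k + r * 9) + 9 * (2 * (q + 3 * f + x))
      lhs = solve-∀
      rhs : ∀ j p q r f g x y → 2 * (j + q * 9) + 9 * ((p + 3 * f + x) + (r + 3 * g + y))
          ≡ 9 * (p + r + 2 * q) + (2 * j + 9 * (x + y) + (f + g) * 27)
      rhs = solve-∀
      cancelled : 9 * (p + r + 2 * q) + (L + 2 * occ d q * 27) ≡ 9 * (p + r + 2 * q) + (R + (occ d p + occ d r) * 27)
      cancelled = trans (lhs (toℕ i) (toℕ k) p q r (occ d q) (pre b j d))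
        (trans (cong₂ (λ x y → x + 9 * y) length-balance (sym (count-balance d)))
               (rhs (toℕ j) p q r (occ d p) (occ d r) (pre a i d) (pre c k d)))

-- With a common offset, the length balance gives `p + r ≡ 2 * q`. The length terms then drop out of
-- the count balance, and so do the partial blocks by the given alternative; the rest is divisible
-- by 3.
same-offset : ∀ p q r i → (let a = word p; b = word q; c = word r) →
  Balanced (toℕ i + p * 9) (toℕ i + q * 9) (toℕ i + r * 9) →
  ((∀ d → pre a i d + pre c i d ≡ 2 * pre b i d) ⊎
   (∀ d → pre a i d + pre c i d + 6 * δ b d ≡ 2 * pre b i d + 3 * (δ a d + δ c d))) →
  Balanced p q r ⊎ Balanced (suc p) (suc q) (suc r)
same-offset p q r i bal = Sum.map before after
  where
  open ≡-Reasoning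
  a = word p
  b = word q
  c = word r
  quotients : p + r ≡ 2 * q
  quotients = *-cancelʳ-≡ (p + r) (2 * q) 9 (+-cancelˡ-≡ (2 * toℕ i) _ _ (trans (lhs (toℕ i) p r) (trans (proj₁ bal) (rhs (toℕ i) q))))
    where
    lhs : ∀ i p r → 2 * i + (p + r) * 9 ≡ i + p * 9 + (i + r * 9)
    lhs = solve-∀
    rhs : ∀ i q → 2 * (i + q * 9) ≡ 2 * i + (2 * q) * 9
    rhs = solve-∀

  before : (∀ d → pre a i d + pre c i d ≡ 2 * pre b i d) → Balanced p q r
  before e = quotients , λ d → *-cancelˡ-≡ _ _ 3 (+-cancelˡ-≡ (2 * q + 2 * pre b i d) _ _ (begin
    2 * q + 2 * pre b i d + 3 * (occ d p + occ d r)                  ≡⟨ cong₂ (λ x y → x + y + 3 * (occ d p + occ d r)) (sym quotients) (sym (e d)) ⟩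
    p + r + (pre a i d + pre c i d) + 3 * (occ d p + occ d r)        ≡⟨ lhs p r (occ d p) (occ d r) (pre a i d) (pre c i d) ⟩
    (p + 3 * occ d p + pre a i d) + (r + 3 * occ d r + pre c i d)    ≡⟨ count-balance p q r i i i bal d ⟩
    2 * (q + 3 * occ d q + pre b i d)                              ≡⟨ rhs q (occ d q) (pre b i d) ⟩
    2 * q + 2 * pre b i d + 3 * (2 * occ d q)                      ∎))
    where
    lhs : ∀ p r f g x y → p + r + (x + y) + 3 * (f + g) ≡ (p + 3 * f + x) + (r + 3 * g + y)
    lhs = solve-∀
    rhs : ∀ q f x → 2 * (q + 3 * f + x) ≡ 2 * q + 2 * x + 3 * (2 * f)
    rhs = solve-∀

  after : (∀ d → pre a i d + pre c i d + 6 * δ b d ≡ 2 * pre b i d + 3 * (δ a d + δ c d)) →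
          Balanced (suc p) (suc q) (suc r)
  after e = occ-suc-balanced quotients λ d → *-cancelˡ-≡ _ _ 3 (+-cancelˡ-≡ (2 * q + 2 * pre b i d) _ _ (begin
    2 * q + 2 * pre b i d + 3 * ((occ d p + δ a d) + (occ d r + δ c d))
      ≡⟨ lhs₁ (2 * q) (2 * pre b i d) (occ d p) (occ d r) (δ a d) (δ c d) ⟩
    2 * q + 3 * (occ d p + occ d r) + (2 * pre b i d + 3 * (δ a d + δ c d))
      ≡⟨ cong₂ (λ x y → x + 3 * (occ d p + occ d r) + y) (sym quotients) (sym (e d)) ⟩
    p + r + 3 * (occ d p + occ d r) + (pre a i d + pre c i d + 6 * δ b d)
      ≡⟨ lhs₂ p r (occ d p) (occ d r) (pre a i d) (pre c i d) (δ b d) ⟩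
    (p + 3 * occ d p + pre a i d) + (r + 3 * occ d r + pre c i d) + 6 * δ b d
      ≡⟨ cong (_+ 6 * δ b d) (count-balance p q r i i i bal d) ⟩
    2 * (q + 3 * occ d q + pre b i d) + 6 * δ b d
      ≡⟨ rhs q (occ d q) (pre b i d) (δ b d) ⟩
    2 * q + 2 * pre b i d + 3 * (2 * (occ d q + δ b d)) ∎))
    where
    lhs₁ : ∀ q x f g y z → q + x + 3 * ((f + y) + (g + z)) ≡ q + 3 * (f + g) + (x + 3 * (y + z))
    lhs₁ = solve-∀
    lhs₂ : ∀ p r f g x y z → p + r + 3 * (f + g) + (x + y + 6 * z) ≡ (p + 3 * f + x) + (r + 3 * g + y) + 6 * z
    lhs₂ = solve-∀
    rhs : ∀ q f x z → 2 * (q + 3 * f + x) + 6 * z ≡ 2 * q + 2 * x + 3 * (2 * (f + z))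
    rhs = solve-∀

realign : ∀ p q r i j k → Balanced (toℕ i + p * 9) (toℕ j + q * 9) (toℕ k + r * 9) →
  Aligned i j k (word p) (word q) (word r) →
  toℕ i ≡ toℕ j × toℕ j ≡ toℕ k × (Balanced p q r ⊎ Balanced (suc p) (suc q) (suc r))
realign p q r i .i .i bal ((refl , refl) , same) = refl , refl , same-offset p q r i bal same

descend : ∀ p q r i j k → Balanced (toℕ i + p * 9) (toℕ j + q * 9) (toℕ k + r * 9) →
  toℕ i ≡ toℕ j × toℕ j ≡ toℕ k × (Balanced p q r ⊎ Balanced (suc p) (suc q) (suc r))
descend p q r i j k bal = realign p q r i j k bal
  (congruent⇒aligned i j k (lengths-mod p q r i j k bal) (word p) (word q) (word r) (counts-mod p q r i j k bal))

private
  quotient-< : ∀ {i j p q} → i ≡ j → i + p * 9 < j + q * 9 → p < q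
  quotient-< {i} {p = p} {q} refl lt = *-cancelʳ-< 9 p q (+-cancelˡ-< i (p * 9) (q * 9) lt)

  suc-quotient-< : ∀ k {r} → 2 ≤ r → suc r < k + r * 9
  suc-quotient-< k {r} 2≤r = ≤-trans (begin
    2 + r        ≤⟨ +-monoˡ-≤ r 2≤r ⟩
    r + r        ≡⟨ twice r ⟩
    r * 2        ≤⟨ *-monoʳ-≤ r (s≤s (s≤s z≤n)) ⟩
    r * 9        ∎) (m≤n+m (r * 9) k)
    where
    open ≤-Reasoning
    twice : ∀ r → r + r ≡ r * 2
    twice = solve-∀

-- Infinite descent on the right end. Equal offsets give p < q < r, so r is at least 2 and even the
-- rounded-up position `suc r` is smaller than o.
unbalanced-below : ∀ n {l m o} → o < n → l < m → m < o → ¬ Balanced l m o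
unbalanced-below (suc n) {l} {m} {o} = go (l divMod 9) (m divMod 9) (o divMod 9)
  where
  go : ∀ {l m o} → DivMod l 9 → DivMod m 9 → DivMod o 9 → o < suc n → l < m → m < o → ¬ Balanced l m o
  go (result p i refl) (result q j refl) (result r k refl) o<n l<m m<o bal =
    let i≡j , j≡k , boundary = descend p q r i j k bal
        p<q = quotient-< i≡j l<m
        q<r = quotient-< j≡k m<o
        sr<o = suc-quotient-< (toℕ k) (≤-trans (s≤s (≤-trans (s≤s z≤n) p<q)) q<r)
        sr<n = <-≤-trans sr<o (≤-pred o<n)
    in [ unbalanced-below n (<-trans (n<1+n r) sr<n) p<q q<r
       , unbalanced-below n sr<n (s≤s p<q) (s≤s q<r) ]′ boundary

unbalanced : ∀ {l m o} → l < m → m < o → ¬ Balanced l m o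
unbalanced {o = o} = unbalanced-below (suc o) (n<1+n o)

-- Paths in rooted forests

map-split : ∀ {A B : Set} (f : A → B) xs {ys zs} → map f xs ≡ ys ++ zs →
  ∃₂ λ us vs → xs ≡ us ++ vs × map f us ≡ ys × map f vs ≡ zs
map-split f xs       {[]}     e = [] , xs , refl , refl , e
map-split f (x ∷ xs) {y ∷ ys} e =
  let us , vs , xs≡ , us↦ , vs↦ = map-split f xs (∷-injectiveʳ e)
  in x ∷ us , vs , cong (x ∷_) xs≡ , cong₂ _∷_ (∷-injectiveˡ e) us↦ , vs↦

-- Rooted forests: Adj u v reads "u is the parent of v".
module Forest (G : Graph) (parent-unique : ∀ {x y z} → Adj G x z → Adj G y z → x ≡ y)
              {C : Set} (colour : V G → C) where

  private
    _↦_ = Adj G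
    _⊑_ = Star (Adj G)

  -- N accumulates f along the way down, so the weight of a descending path is a difference of two
  -- values of N.
  record IsPotential (f : C → ℕ) (N : V G → ℕ) : Set where
    field step : ∀ {u v} → u ↦ v → N v ≡ N u + f (colour v)

    mono : ∀ {u v} → u ⊑ v → N u ≤ N v
    mono ε        = ≤-refl
    mono (a ◅ as) = ≤-trans (≤-trans (m≤m+n _ _) (≤-reflexive (sym (step a)))) (mono as)

  weight : (C → ℕ) → List (V G) → ℕ
  weight f p = sum (map (λ v → f (colour v)) p)

  weight-↭ : ∀ f p q → map colour p ↭ map colour q → weight f p ≡ weight f q
  weight-↭ f p q perm = trans (cong sum (map-∘ p)) (trans (sum-↭ (map⁺ f perm)) (cong sum (sym (map-∘ q))))

  -- The lists of `Down` and `Up` omit the upper end, while that of `Walk` includes both ends and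
  -- the apex.
  data Down : V G → List (V G) → V G → Set where
    []  : ∀ {x} → Down x [] x
    _∷_ : ∀ {x y ys t} → x ↦ y → Down y ys t → Down x (y ∷ ys) t

  data Up : V G → List (V G) → V G → Set where
    [_] : ∀ {x y} → x ↦ y → Up y (y ∷ []) x
    _∷_ : ∀ {x y p g} → x ↦ y → Up x p g → Up y (y ∷ p) g

  data Walk : V G → V G → V G → List (V G) → Set where
    apex : ∀ {z ys t} → Down z ys t → Walk z z t (z ∷ ys)
    _∷_  : ∀ {x y z t p} → x ↦ y → Walk x z t p → Walk y z t (y ∷ p)

  -- After a step down the path cannot rise: by uniqueness of parents it would return to x.
  prepend-down : ∀ {x y z t p} → x ↦ y → All (x ≢_) p → Walk y z t p → ∃₂ λ z t → Walk x z t (x ∷ p)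
  prepend-down x↦y _            (apex d)              = _ , _ , apex (x↦y ∷ d)
  prepend-down x↦y (_ ∷ x≢ ∷ _) (x′↦y ∷ w@(apex _)) = contradiction (parent-unique x↦y x′↦y) x≢
  prepend-down x↦y (_ ∷ x≢ ∷ _) (x′↦y ∷ w@(_ ∷ _))  = contradiction (parent-unique x↦y x′↦y) x≢

  path⇒walk : ∀ {x} p → IsPath G (x ∷ p) → ∃₂ λ z t → Walk x z t (x ∷ p)
  path⇒walk {x} []      _ = x , x , apex []
  path⇒walk {x} (y ∷ p) (x∉ ∷ unique , link ∷ links) with path⇒walk p (unique , links) | link
  ... | z , t , w | inj₂ y↦x = z , t , y↦x ∷ w
  ... | z , t , w | inj₁ x↦y = prepend-down x↦y x∉ w

  down-⊑ : ∀ {x ys t} → Down x ys t → x ⊑ t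
  down-⊑ []      = ε
  down-⊑ (a ∷ d) = a ◅ down-⊑ d

  up-⊑ : ∀ {y p g} → Up y p g → g ⊑ y
  up-⊑ [ a ]   = a ◅ ε
  up-⊑ (a ∷ u) = up-⊑ u ◅◅ (a ◅ ε)

  walk-⊑ˡ : ∀ {y z t p} → Walk y z t p → z ⊑ y
  walk-⊑ˡ (apex _) = ε
  walk-⊑ˡ (a ∷ w)  = walk-⊑ˡ w ◅◅ (a ◅ ε)

  module _ {f N} (pot : IsPotential f N) where
    open IsPotential pot

    down-weight : ∀ {x ys t} → Down x ys t → N x + weight f ys ≡ N t
    down-weight []      = +-identityʳ _
    down-weight {x} {y ∷ ys} (a ∷ d) = begin
      N x + (f (colour y) + weight f ys)   ≡⟨ +-assoc (N x) _ _ ⟨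
      N x + f (colour y) + weight f ys     ≡⟨ cong (_+ weight f ys) (step a) ⟨
      N y + weight f ys                    ≡⟨ down-weight d ⟩
      N _                                  ∎
      where open ≡-Reasoning

    up-weight : ∀ {y p g} → Up y p g → N g + weight f p ≡ N y
    up-weight {y} {g = g} [ a ] = trans (cong (N g +_) (+-identityʳ _)) (sym (step a))
    up-weight {y} {y ∷ p} {g} (_∷_ {x} a u) = begin
      N g + (f (colour y) + weight f p)    ≡⟨ swap (N g) (f (colour y)) (weight f p) ⟩
      N g + weight f p + f (colour y)      ≡⟨ cong (_+ f (colour y)) (up-weight u) ⟩
      N x + f (colour y)                   ≡⟨ step a ⟨
      N y                                  ∎
      where
      open ≡-Reasoning
      swap : ∀ a b c → a + (b + c) ≡ a + c + b
      swap = solve-∀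

    -- The differences of N along the two legs both leave out the apex, hence the last term.
    walk-weight : ∀ {y z t p} → Walk y z t p → 2 * N z + weight f p ≡ N y + N t + f (colour z)
    walk-weight {z = z} {t} {_ ∷ ys} (apex d) =
      trans (regroup (N z) (f (colour z)) (weight f ys)) (cong (λ n → N z + n + f (colour z)) (down-weight d))
      where
      regroup : ∀ a b c → 2 * a + (b + c) ≡ a + (a + c) + b
      regroup = solve-∀
    walk-weight {y} {z} {t} {_ ∷ p} (_∷_ {x} a w) = begin
      2 * N z + (f (colour y) + weight f p)       ≡⟨ swap (2 * N z) (f (colour y)) (weight f p) ⟩
      2 * N z + weight f p + f (colour y)         ≡⟨ cong (_+ f (colour y)) (walk-weight w) ⟩
      N x + N t + f (colour z) + f (colour y)     ≡⟨ swap′ (N x) (N t) (f (colour z)) (f (colour y)) ⟩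
      N x + f (colour y) + N t + f (colour z)     ≡⟨ cong (λ n → n + N t + f (colour z)) (step a) ⟨
      N y + N t + f (colour z)                    ∎
      where
      open ≡-Reasoning
      swap : ∀ a b c → a + (b + c) ≡ a + c + b
      swap = solve-∀
      swap′ : ∀ a b c d → a + b + c + d ≡ a + d + b + c
      swap′ = solve-∀

  down-split : ∀ {x t} ys {zs} → Down x (ys ++ zs) t → ∃ λ g → Down x ys g × Down g zs t
  down-split []       d       = _ , [] , d
  down-split (y ∷ ys) (a ∷ d) = let g , d₁ , d₂ = down-split ys d in g , a ∷ d₁ , d₂

  -- In both cases g is the upper end of the cut edge: the last vertex of the first half on a
  -- descending leg, the first vertex of the second half on a climbing one.
  walk-split : ∀ {x y z t} p {q₁ q} → Walk y z t (x ∷ p ++ q₁ ∷ q) →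
    (∃ λ g → Walk y z g (x ∷ p) × Down g (q₁ ∷ q) t) ⊎
    (∃ λ g → Up y (x ∷ p) g × Walk g z t (q₁ ∷ q))
  walk-split p        (apex d) = let g , d₁ , d₂ = down-split p d in inj₁ (g , apex d₁ , d₂)
  walk-split []       (a ∷ w)  with w
  ... | apex d = inj₂ (_ , [ a ] , w)
  ... | _ ∷ _  = inj₂ (_ , [ a ] , w)
  walk-split (_ ∷ p)  (a ∷ w)  with w
  ... | w@(apex _) = Sum.map (λ (g , w₁ , d) → g , a ∷ w₁ , d) (λ (g , u , w₂) → g , a ∷ u , w₂) (walk-split p w)
  ... | w@(_ ∷ _)  = Sum.map (λ (g , w₁ , d) → g , a ∷ w₁ , d) (λ (g , u , w₂) → g , a ∷ u , w₂) (walk-split p w)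

  -- `left` and `right` are the children of the apex on the two legs; `position` puts m on the leg
  -- to t, apex included.
  record Fork (y z m t : V G) : Set where
    field
      {left right} : V G
      left≢right : left ≢ right
      z↦left     : z ↦ left
      z↦right    : z ↦ right
      left⊑y     : left ⊑ y
      right⊑t    : right ⊑ t
      position     : m ≡ z ⊎ right ⊑ m

  -- y and t are the ends of a path with apex z, and m, a proper ancestor
  -- of t, is the upper end of the edge separating the two halves.
  record Halved (y z m t : V G) : Set where
    field
      z⊑m   : z ⊑ m
      below : ∃ λ c → m ↦ c × c ⊑ t
      shape : y ≡ z ⊎ Fork y z m t
      -- Free of subtraction, this says (N y - N z) + f (colour z) + (N m - N z) = N t - N m: the
      -- half with the apex weighs as much as the other.
      halves : ∀ {f N} → IsPotential f N → N y + 2 * N m + f (colour z) ≡ N t + 2 * N z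

  fork-left : ∀ {x y z g t p q₁ q} → x ↦ y → Walk x z g p → Down g (q₁ ∷ q) t →
    Unique (y ∷ p ++ q₁ ∷ q) → Fork y z g t
  fork-left a (apex []) (b ∷ e) ((_ ∷ y≢ ∷ _) ∷ _) = record
    { left≢right = y≢ ; z↦left = a ; z↦right = b ; left⊑y = ε ; right⊑t = down-⊑ e ; position = inj₁ refl }
  fork-left a (apex (b ∷ d)) e ((_ ∷ y≢ ∷ _) ∷ _) = record
    { left≢right = y≢ ; z↦left = a ; z↦right = b ; left⊑y = ε
    ; right⊑t = down-⊑ d ◅◅ down-⊑ e ; position = inj₂ (down-⊑ d) }
  fork-left a (b ∷ w) e (_ ∷ unique) = record
    { Fork (fork-left b w e unique) hiding (left⊑y)
    ; left⊑y = Fork.left⊑y (fork-left b w e unique) ◅◅ (a ◅ ε) }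

  fork-up : ∀ {x y z t p} → x ↦ y → Walk x z t p → Unique (y ∷ p) → t ≡ z ⊎ Fork t z y y
  fork-up a (apex []) _ = inj₁ refl
  fork-up a (apex (b ∷ d)) ((_ ∷ y≢ ∷ _) ∷ _) = inj₂ record
    { left≢right = ≢-sym y≢ ; z↦left = b ; z↦right = a ; left⊑y = down-⊑ d ; right⊑t = ε ; position = inj₂ ε }
  fork-up a (b ∷ w) (_ ∷ unique) = Sum.map₂ extend (fork-up b w unique)
    where
    extend : Fork _ _ _ _ → Fork _ _ _ _
    extend fork = record
      { Fork fork hiding (right⊑t ; position)
      ; right⊑t = Fork.right⊑t fork ◅◅ (a ◅ ε) ; position = inj₂ (Fork.right⊑t fork ◅◅ (a ◅ ε)) }

  up-last : ∀ {y p g v w q} → Up y p g → Unique (p ++ v ∷ w ∷ q) → ∃ λ c → g ↦ c × c ⊑ y × w ≢ c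
  up-last [ a ]   ((_ ∷ y≢ ∷ _) ∷ _) = _ , a , ε , ≢-sym y≢
  up-last (a ∷ u) (_ ∷ unique)       = let c , g↦c , c⊑ , w≢ = up-last u unique in c , g↦c , c⊑ ◅◅ (a ◅ ε) , w≢

  up-first : ∀ {y p g} → Up y p g → ∃ λ c → g ↦ c × c ⊑ y
  up-first [ a ]   = _ , a , ε
  up-first (a ∷ u) = let c , g↦c , c⊑ = up-first u in c , g↦c , c⊑ ◅◅ (a ◅ ε)

  halve-down : ∀ {y z g t p q₁ q} → Walk y z g p → Down g (q₁ ∷ q) t → Unique (p ++ q₁ ∷ q) →
    (∀ f → weight f p ≡ weight f (q₁ ∷ q)) → Halved y z g t
  halve-down {y} {z} {g} {t} {p} {q₁} {q} w d@(b ∷ e) unique weights = record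
    { z⊑m = walk-⊑ʳ w ; below = _ , b , down-⊑ e ; shape = shape w unique ; halves = halves }
    where
    walk-⊑ʳ : ∀ {y z t p} → Walk y z t p → z ⊑ t
    walk-⊑ʳ (apex d) = down-⊑ d
    walk-⊑ʳ (_ ∷ w)  = walk-⊑ʳ w
    shape : ∀ {p} → Walk y z g p → Unique (p ++ q₁ ∷ q) → y ≡ z ⊎ Fork y z g t
    shape (apex _) _      = inj₁ refl
    shape (a ∷ w)  unique = inj₂ (fork-left a w d unique)
    halves : ∀ {f N} → IsPotential f N → N y + 2 * N g + f (colour z) ≡ N t + 2 * N z
    halves {f} {N} pot = begin
      N y + 2 * N g + f (colour z)        ≡⟨ regroup (N y) (N g) (f (colour z)) ⟩
      N g + (N y + N g + f (colour z))    ≡⟨ cong (N g +_) (walk-weight pot w) ⟨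
      N g + (2 * N z + weight f p)        ≡⟨ cong (λ n → N g + (2 * N z + n)) (weights f) ⟩
      N g + (2 * N z + weight f (q₁ ∷ q)) ≡⟨ regroup′ (N g) (2 * N z) (weight f (q₁ ∷ q)) ⟩
      N g + weight f (q₁ ∷ q) + 2 * N z   ≡⟨ cong (_+ 2 * N z) (down-weight pot d) ⟩
      N t + 2 * N z                       ∎
      where
      open ≡-Reasoning
      regroup : ∀ a b c → a + 2 * b + c ≡ b + (a + b + c)
      regroup = solve-∀
      regroup′ : ∀ a b c → a + (b + c) ≡ a + c + b
      regroup′ = solve-∀

  -- The path is read backwards: the cut lies on the leg that climbs from y, so y takes the role of
  -- the lower end.
  halve-up : ∀ {y z g t p q} → Up y p g → Walk g z t q → Unique (p ++ q) →
    (∀ f → weight f p ≡ weight f q) → Halved t z g y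
  halve-up {y} {z} {g} {t} {p} {q} u w unique weights = record
    { z⊑m = walk-⊑ˡ w ; below = up-first u ; shape = shape w unique ; halves = halves }
    where
    drop : ∀ p {q : List (V G)} → Unique (p ++ q) → Unique q
    drop []      un       = un
    drop (_ ∷ p) (_ ∷ un) = drop p un
    shape : ∀ {q} → Walk g z t q → Unique (p ++ q) → t ≡ z ⊎ Fork t z g y
    shape (apex [])      _      = inj₁ refl
    shape (apex (b ∷ d)) unique = let c , z↦c , c⊑y , b≢c = up-last u unique in inj₂ record
      { left≢right = b≢c ; z↦left = b ; z↦right = z↦c ; left⊑y = down-⊑ d ; right⊑t = c⊑y ; position = inj₁ refl }
    shape (a ∷ w)        unique = Sum.map₂ extend (fork-up a w (drop p unique))
      where
      extend : Fork t z g g → Fork t z g y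
      extend fork = record { Fork fork hiding (right⊑t) ; right⊑t = Fork.right⊑t fork ◅◅ up-⊑ u }
    halves : ∀ {f N} → IsPotential f N → N t + 2 * N g + f (colour z) ≡ N y + 2 * N z
    halves {f} {N} pot = begin
      N t + 2 * N g + f (colour z)        ≡⟨ regroup (N t) (N g) (f (colour z)) ⟩
      N g + (N g + N t + f (colour z))    ≡⟨ cong (N g +_) (walk-weight pot w) ⟨
      N g + (2 * N z + weight f q)        ≡⟨ cong (λ n → N g + (2 * N z + n)) (weights f) ⟨
      N g + (2 * N z + weight f p)        ≡⟨ regroup′ (N g) (2 * N z) (weight f p) ⟩
      N g + weight f p + 2 * N z          ≡⟨ cong (_+ 2 * N z) (up-weight pot u) ⟩
      N y + 2 * N z                       ∎
      where
      open ≡-Reasoning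
      regroup : ∀ a b c → a + 2 * b + c ≡ b + (b + a + c)
      regroup = solve-∀
      regroup′ : ∀ a b c → a + (b + c) ≡ a + c + b
      regroup′ = solve-∀

  -- A permutation preserves the weight for every f; these equalities are all that is kept of the
  -- anagram.
  anagram⇒halved : ∀ p → IsPath G p → IsAnagram (map colour p) →
    ∃₂ λ y z → ∃₂ λ m t → Halved y z m t
  anagram⇒halved p path (W , P , W≢[] , P↭W , e) with map-split colour p {W} {P} e
  ... | []     , _      , refl , refl , refl = contradiction refl W≢[]
  ... | _ ∷ _  , []     , refl , refl , refl with () ← ↭-length P↭W
  ... | x ∷ us , v ∷ vs , refl , refl , refl = halved (walk-split us (proj₂ (proj₂ (path⇒walk (us ++ v ∷ vs) path))))
    where
    weights : ∀ f → weight f (x ∷ us) ≡ weight f (v ∷ vs)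
    weights f = weight-↭ f (x ∷ us) (v ∷ vs) (↭-sym P↭W)
    halved : ∀ {y z t} →
      (∃ λ g → Walk y z g (x ∷ us) × Down g (v ∷ vs) t) ⊎ (∃ λ g → Up y (x ∷ us) g × Walk g z t (v ∷ vs)) →
      ∃₂ λ y z → ∃₂ λ m t → Halved y z m t
    halved (inj₁ (g , w , d)) = _ , _ , _ , _ , halve-down w d (proj₁ path) weights
    halved (inj₂ (g , u , w)) = _ , _ , _ , _ , halve-up u w (proj₁ path) weights

-- Subdivisions

no-position : ∀ {n} → Fin n → n ≢ 0
no-position () refl

module _ {G : EdgeGraph} {s : Edge G → ℕ} where

  private
    _↦_ = SubAdj G s

  subdivision-parent-unique : (∀ {e e′} → tgt G e ≡ tgt G e′ → e ≡ e′) →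
    ∀ {x y v} → x ↦ v → y ↦ v → x ≡ y
  subdivision-parent-unique tgt-injective p q = go p q refl
    where
    -- The equation between the lower ends is an argument of its own because `tgt G e` is no
    -- constructor form to unify with.
    go : ∀ {x y v v′} → x ↦ v → y ↦ v′ → v ≡ v′ → x ≡ y
    go (direct e p)     (direct e′ q) eq with refl ← tgt-injective (inj₁-injective eq) = refl
    go (direct e p)     (last e′ i q) eq with refl ← tgt-injective (inj₁-injective eq) = contradiction p (no-position i)
    go (last e i p)     (direct e′ q) eq with refl ← tgt-injective (inj₁-injective eq) = contradiction q (no-position i)
    go (last e i p)     (last e′ j q) eq with refl ← tgt-injective (inj₁-injective eq)
      = cong (λ k → inj₂ (e , k)) (toℕ-injective (suc-injective (trans p (sym q))))
    go (first e i p)    (first e i q)    refl = refl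
    go (first e i p)    (middle e j i q) refl = contradiction (trans (sym q) p) λ ()
    go (middle e j i p) (first e i q)    refl = contradiction (trans (sym p) q) λ ()
    go (middle e i k p) (middle e j k q) refl = cong (λ k → inj₂ (e , k)) (toℕ-injective (suc-injective (trans (sym p) q)))

  data Starts (e : Edge G) : SubVert G s → Set where
    direct : s e ≡ 0 → Starts e (inj₁ (tgt G e))
    first  : ∀ i → toℕ i ≡ 0 → Starts e (inj₂ (e , i))

  starts-unique : ∀ {e x y} → Starts e x → Starts e y → x ≡ y
  starts-unique (direct p)  (direct q)  = refl
  starts-unique (direct p)  (first i q) = contradiction p (no-position i)
  starts-unique (first i p) (direct q)  = contradiction q (no-position i)
  starts-unique (first i p) (first j q) = cong (λ k → inj₂ (_ , k)) (toℕ-injective (trans p (sym q)))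

  -- A division vertex has a single child, so only original vertices branch, and they do so into
  -- different edge paths.
  branching : ∀ {z x y} → z ↦ x → z ↦ y → x ≢ y →
    ∃₂ λ e e′ → z ≡ inj₁ (src G e) × z ≡ inj₁ (src G e′) × Starts e x × Starts e′ y
  branching p q x≢y = go p q refl x≢y
    where
    go : ∀ {z z′ x y} → z ↦ x → z′ ↦ y → z ≡ z′ → x ≢ y →
      ∃₂ λ e e′ → z ≡ inj₁ (src G e) × z ≡ inj₁ (src G e′) × Starts e x × Starts e′ y
    go (direct e p)     (direct e′ q)    eq   _  = e , e′ , refl , eq , direct p , direct q
    go (direct e p)     (first e′ j q)   eq   _  = e , e′ , refl , eq , direct p , first j q
    go (first e i p)    (direct e′ q)    eq   _  = e , e′ , refl , eq , first i p , direct q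
    go (first e i p)    (first e′ j q)   eq   _  = e , e′ , refl , eq , first i p , first j q
    go (middle e i j p) (middle e i k q) refl x≢ = contradiction (cong (λ k → inj₂ (e , k)) (toℕ-injective (trans p (sym q)))) x≢
    go (middle e i j p) (last e i q)     refl _  = contradiction (trans p q) (<⇒≢ (toℕ<n j))
    go (last e i p)     (middle e i j q) refl _  = contradiction (trans q p) (<⇒≢ (toℕ<n j))
    go (last e i p)     (last e i q)     refl x≢ = contradiction refl x≢

-- Serves to pass from the colours in `Fin 10` back to `Colour`.
anagram-map : ∀ {A B : Set} {w : List A} (f : A → B) → IsAnagram w → IsAnagram (map f w)
anagram-map f ([]    , P , W≢[] , perm , e)    = contradiction refl W≢[]
anagram-map f (x ∷ W , P , _    , perm , refl) = map f (x ∷ W) , map f P , (λ ()) , map⁺ f perm , map-++ f (x ∷ W) P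

-- The colouring

odd? : ℕ → Bool
odd? zero    = false
odd? (suc n) = not (odd? n)

-- The numbers of odd and of even positions below the argument; on an edge, marks stand at odd
-- positions and letters at even ones.
odds evens : ℕ → ℕ
odds  zero    = 0
odds  (suc n) = if odd? n then suc (odds n) else odds n
evens zero    = 0
evens (suc n) = if odd? n then evens n else suc (evens n)

odds-4+ : ∀ n → odds (4 + n) ≡ 2 + odds n
odds-4+ n with odd? n
... | true  = refl
... | false = refl

evens-4+ : ∀ n → evens (4 + n) ≡ 2 + evens n
evens-4+ n with odd? n
... | true  = refl
... | false = refl

odds-4* : ∀ n → odds (n * 4) ≡ n + n
odds-4* zero    = refl
odds-4* (suc n) = trans (odds-4+ (n * 4)) (cong suc (trans (cong suc (odds-4* n)) (sym (+-suc n n))))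

evens-4* : ∀ n → evens (n * 4) ≡ n + n
evens-4* zero    = refl
evens-4* (suc n) = trans (evens-4+ (n * 4)) (cong suc (trans (cong suc (evens-4* n)) (sym (+-suc n n))))

odds-≤-suc : ∀ n → odds n ≤ odds (suc n)
odds-≤-suc n with odd? n
... | true  = n≤1+n _
... | false = ≤-refl

odds-mono : ∀ {m n} → m ≤′ n → odds m ≤ odds n
odds-mono ≤′-refl       = ≤-refl
odds-mono (≤′-step {n} m≤n) = ≤-trans (odds-mono m≤n) (odds-≤-suc n)

Colour = Fin 6 ⊎ Fin 4

pattern letter c = inj₁ c
pattern ♭ = inj₂ 0F
pattern ♯ = inj₂ 1F
pattern ⋆ = inj₂ 2F

-- How often each kind of colour occurs on the way from the root to a vertex, that vertex included.
record State : Set where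
  constructor ⟨_,_,_,_⟩
  field letters flats sharps stars : ℕ
open State

advance : Colour → State → State
advance (letter _) ⟨ x , a , b , c ⟩ = ⟨ suc x , a , b , c ⟩
advance ♭ ⟨ x , a , b , c ⟩ = ⟨ x , suc a , b , c ⟩
advance ♯ ⟨ x , a , b , c ⟩ = ⟨ x , a , suc b , c ⟩
advance ⋆ ⟨ x , a , b , c ⟩ = ⟨ x , a , b , suc c ⟩
advance (inj₂ 3F) σ = σ

halfMark : ∀ {P : Set} → Dec P → Colour
halfMark (yes _) = ♭
halfMark (no _)  = ♯

innerColour : ℕ → ℕ → ℕ → Colour
-- `odds (suc f)` is the rank, counted from 1, of the mark at position f; the first n marks are ♭.
innerColour n x f = if odd? f then halfMark (odds (suc f) ≤? n) else letter (word (x + evens f))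

-- The state after m division vertices of an edge with parameter n that leaves a vertex of depth k;
-- a counts the ♭, and also the ♯, above that edge.
along : ℕ → ℕ → ℕ → ℕ → State
along a k n m = ⟨ 2 * a + evens m , a + (odds m ⊓ n) , a + (odds m ∸ n) , suc k ⟩

along-suc : ∀ a k n f → along a k n (suc f) ≡ advance (innerColour n (2 * a) f) (along a k n f)
along-suc a k n f with odd? f
... | false = cong (λ x → ⟨ x , a + (odds f ⊓ n) , a + (odds f ∸ n) , suc k ⟩) (+-suc (2 * a) (evens f))
... | true with suc (odds f) ≤? n
...   | yes o<n = cong₂ (λ p q → ⟨ 2 * a + evens f , p , q , suc k ⟩)
        (trans (cong (a +_) (trans (m≤n⇒m⊓n≡m o<n) (cong suc (sym (m≤n⇒m⊓n≡m (<⇒≤ o<n)))))) (+-suc a _))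
        (cong (a +_) (trans (m≤n⇒m∸n≡0 o<n) (sym (m≤n⇒m∸n≡0 (<⇒≤ o<n)))))
...   | no o≮n = let n≤o = ≮⇒≥ o≮n in cong₂ (λ p q → ⟨ 2 * a + evens f , p , q , suc k ⟩)
        (cong (a +_) (trans (m≥n⇒m⊓n≡n (m≤n⇒m≤1+n n≤o)) (sym (m≥n⇒m⊓n≡n n≤o))))
        (trans (cong (a +_) (+-∸-assoc 1 n≤o)) (+-suc a _))

innerColour-letter : ∀ n x f {c} → innerColour n x f ≡ letter c → c ≡ word (x + evens f) × evens (suc f) ≡ suc (evens f)
innerColour-letter n x f eq with odd? f
innerColour-letter n x f refl | false = refl , refl
... | true with suc (odds f) ≤? n
innerColour-letter n x f () | true | yes _
innerColour-letter n x f () | true | no _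

-- Edge parameters, colours and colour counts of the subdivided tree

module _ (d h : ℕ) where

  -- The argument is the height of an edge's lower end above the leaves; the value 0 leaves leaf
  -- edges undivided.
  unit : ℕ → ℕ
  unit zero    = 0
  unit (suc r) = suc d ^ r

  size : List (Fin d) → Fin d → ℕ
  size l i = suc (toℕ i) * unit (h ∸ suc (length l))

  -- Sum of the edge parameters from the root: the number of ♭ and of ♯ passed, and half the number
  -- of letters.
  above : List (Fin d) → ℕ
  above []      = 0
  above (i ∷ l) = above l + size l i

  subdivide : TreeEdge d h → ℕ
  subdivide ((l , _) , i) = size l i * 4

  T = CompleteTree d h
  S = Subdivision T subdivide

  -- The first argument is the height above the leaves; a leaf continues the word with its next
  -- letter.
  outerColour : ℕ → ℕ → Colour
  outerColour zero    x = letter (word x)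
  outerColour (suc _) x = ⋆

  colour : V S → Colour
  colour (inj₁ (l , _))             = outerColour (h ∸ length l) (2 * above l)
  colour (inj₂ (((l , _) , i) , f)) = innerColour (size l i) (2 * above l) (toℕ f)

  outerState : ℕ → List (Fin d) → State
  outerState zero    l = ⟨ suc (2 * above l) , above l , above l , length l ⟩
  outerState (suc _) l = ⟨ 2 * above l , above l , above l , suc (length l) ⟩

  passed : List (Fin d) → Fin d → ℕ → State
  passed l i = along (above l) (length l) (size l i)

  state : V S → State
  state (inj₁ (l , _))             = outerState (h ∸ length l) l
  state (inj₂ (((l , _) , i) , f)) = passed l i (suc (toℕ f))

  outerState-internal : ∀ {l} i → length l < h → outerState (h ∸ length l) l ≡ passed l i 0
  outerState-internal {l} i lt with h ∸ length l | m<n⇒0<n∸m lt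
  ... | suc _ | _ = trans
    (cong₂ (λ x y → ⟨ x , y , y , suc (length l) ⟩) (sym (+-identityʳ (2 * above l))) (sym (+-identityʳ (above l))))
    (cong (λ y → ⟨ 2 * above l + 0 , above l + 0 , above l + y , suc (length l) ⟩) (sym (0∸n≡0 (size l i))))

  outerState-child : ∀ l i → outerState (h ∸ suc (length l)) (i ∷ l) ≡
    advance (outerColour (h ∸ suc (length l)) (2 * above (i ∷ l)))
            (passed l i (size l i * 4))
  outerState-child l i = trans (cases (h ∸ suc (length l)))
      (cong (advance (outerColour (h ∸ suc (length l)) (2 * above (i ∷ l)))) (sym end))
    where
    n = size l i
    a = above l
    end : along a (length l) n (n * 4) ≡ ⟨ 2 * (a + n) , a + n , a + n , suc (length l) ⟩
    end rewrite odds-4* n | evens-4* n | m≥n⇒m⊓n≡n (m≤m+n n n) | m+n∸n≡m n n =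
      cong (λ x → ⟨ x , a + n , a + n , suc (length l) ⟩) (double a n)
      where
      double : ∀ a n → 2 * a + (n + n) ≡ 2 * (a + n)
      double = solve-∀
    cases : ∀ r → outerState r (i ∷ l) ≡
      advance (outerColour r (2 * above (i ∷ l))) ⟨ 2 * (a + n) , a + n , a + n , suc (length l) ⟩
    cases zero    = refl
    cases (suc _) = refl

  -- Ties the closed formulas of `state` to the colouring; all potentials rest on it.
  state-step : ∀ {u v} → Adj S u v → state v ≡ advance (colour v) (state u)
  state-step (direct e@((l , p) , i) q) = trans (outerState-child l i) (cong (advance (colour (inj₁ (tgt T e))))
    (trans (cong (passed l i) q) (sym (outerState-internal i p))))
  state-step (first e@((l , p) , i) f q) = trans (along-suc _ _ (size l i) (toℕ f)) (cong (advance (colour (inj₂ (e , f))))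
    (trans (cong (passed l i) q) (sym (outerState-internal i p))))
  state-step (middle e@((l , p) , i) f g q) = trans (along-suc _ _ (size l i) (toℕ g))
    (cong (λ m → advance (colour (inj₂ (e , g))) (passed l i m)) q)
  state-step (last e@((l , p) , i) f q) = trans (outerState-child l i)
    (cong (λ m → advance (colour (inj₁ (tgt T e))) (passed l i m)) (sym q))

  letter-index : ∀ v {c} → colour v ≡ letter c → ∃ λ e → letters (state v) ≡ suc e × c ≡ word e
  letter-index (inj₁ (l , _)) eq with h ∸ length l
  letter-index (inj₁ (l , _)) refl | zero = 2 * above l , refl , refl
  letter-index (inj₂ (((l , _) , i) , f)) eq =
    let c≡ , e≡ = innerColour-letter (size l i) (2 * above l) (toℕ f) eq
    in 2 * above l + evens (toℕ f) , trans (cong (2 * above l +_) e≡) (+-suc (2 * above l) _) , c≡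

  child-injective : ∀ {e e′} → tgt T e ≡ tgt T e′ → e ≡ e′
  child-injective {(_ , _) , _} {(_ , _) , _} refl = refl

  parent-unique : ∀ {x y v} → Adj S x v → Adj S y v → x ≡ y
  parent-unique = subdivision-parent-unique {T} {subdivide} child-injective

  -- Potentials of the colouring

  open Forest S parent-unique colour

  private
    _↦_ = Adj S
    _⊑_ = Star (Adj S)
    X A B Z : V S → ℕ
    X v = letters (state v)
    A v = flats (state v)
    B v = sharps (state v)
    Z v = stars (state v)

  isLetter isFlat isSharp isStar : Colour → ℕ
  isLetter = [ (λ _ → 1) , (λ _ → 0) ]′
  isFlat   = [ (λ _ → 0) , δ 0F ]′
  isSharp  = [ (λ _ → 0) , δ 1F ]′
  isStar   = [ (λ _ → 0) , δ 2F ]′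

  potential : (π : State → ℕ) (f : Colour → ℕ) → (∀ c σ → π (advance c σ) ≡ π σ + f c) →
    IsPotential f (λ v → π (state v))
  potential π f eq = record { step = λ {u} {v} a → trans (cong π (state-step a)) (eq (colour v) (state u)) }

  X-potential : IsPotential isLetter X
  X-potential = potential letters isLetter λ where
    (letter _) σ → sym (+-comm _ 1)
    ♭ σ → sym (+-identityʳ _)
    ♯ σ → sym (+-identityʳ _)
    ⋆ σ → sym (+-identityʳ _)
    (inj₂ 3F) σ → sym (+-identityʳ _)

  A-potential : IsPotential isFlat A
  A-potential = potential flats isFlat λ where
    (letter _) σ → sym (+-identityʳ _)
    ♭ σ → sym (+-comm _ 1)
    ♯ σ → sym (+-identityʳ _)
    ⋆ σ → sym (+-identityʳ _)
    (inj₂ 3F) σ → sym (+-identityʳ _)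

  B-potential : IsPotential isSharp B
  B-potential = potential sharps isSharp λ where
    (letter _) σ → sym (+-identityʳ _)
    ♭ σ → sym (+-identityʳ _)
    ♯ σ → sym (+-comm _ 1)
    ⋆ σ → sym (+-identityʳ _)
    (inj₂ 3F) σ → sym (+-identityʳ _)

  Z-potential : IsPotential isStar Z
  Z-potential = potential stars isStar λ where
    (letter _) σ → sym (+-identityʳ _)
    ♭ σ → sym (+-identityʳ _)
    ♯ σ → sym (+-identityʳ _)
    ⋆ σ → sym (+-comm _ 1)
    (inj₂ 3F) σ → sym (+-identityʳ _)

  -- By `letter-index` the letters on the way down spell a prefix of `word`, so their total number
  -- determines how often each of them occurred.
  occ-potential : ∀ c → IsPotential [ (λ x → δ x c) , (λ _ → 0) ]′ (λ v → occ c (X v))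
  occ-potential c = record { step = step }
    where
    step : ∀ {u v} → u ↦ v → occ c (X v) ≡ occ c (X u) + [ (λ x → δ x c) , (λ _ → 0) ]′ (colour v)
    step {u} {v} a = go (colour v) refl
      where
      go : ∀ κ → colour v ≡ κ → occ c (X v) ≡ occ c (X u) + [ (λ x → δ x c) , (λ _ → 0) ]′ κ
      go (letter x) eq = let e , Xv≡ , x≡ = letter-index v eq in begin
        occ c (X v)                   ≡⟨ cong (occ c) Xv≡ ⟩
        occ c e + δ (word e) c        ≡⟨ cong₂ (λ e x → occ c e + δ x c) (suc-injective (trans (sym Xv≡) (Xv≡Xu+ eq))) (sym x≡) ⟩
        occ c (X u) + δ x c           ∎
        where
        open ≡-Reasoning
        Xv≡Xu+ : colour v ≡ letter x → X v ≡ suc (X u)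
        Xv≡Xu+ eq = trans (IsPotential.step X-potential a) (trans (cong (λ κ → X u + isLetter κ) eq) (+-comm (X u) 1))
      go (inj₂ k) eq = trans (cong (occ c) (trans (IsPotential.step X-potential a)
        (trans (cong (λ κ → X u + isLetter κ) eq) (+-identityʳ _)))) (sym (+-identityʳ _))

  -- Paths inside one root-to-leaf path

  marks-adjacent : ∀ {u v j k} → u ↦ v → colour u ≡ inj₂ j → colour v ≡ inj₂ k → j ≡ 1F × k ≡ 2F
  -- An undivided edge ends in a leaf, which carries a letter.
  marks-adjacent (direct ((l , p) , i) q) cu cv with h ∸ suc (length l)
  marks-adjacent (direct ((l , p) , i) q) cu () | zero
  ... | suc r = contradiction q (≢-nonZero⁻¹ _ {{m*n≢0 (suc (toℕ i) * suc d ^ r) 4 {{m*n≢0 (suc (toℕ i)) (suc d ^ r) {{_}} {{m^n≢0 (suc d) r}}}}}})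
  -- Position 0 of an edge is even and carries a letter.
  marks-adjacent (first ((l , p) , i) f q) cu cv rewrite q with () ← cv
  marks-adjacent (middle ((l , p) , i) f g q) cu cv rewrite q with odd? (toℕ f)
  marks-adjacent (middle ((l , p) , i) f g q) cu () | true
  marks-adjacent (middle ((l , p) , i) f g q) () cv | false
  marks-adjacent (last e@((l , p) , i) f q) cu cv = sharp , star (h ∸ suc (length l)) cv
    where
    n = size l i
    star : ∀ {k} r → outerColour r (2 * above (i ∷ l)) ≡ inj₂ k → k ≡ 2F
    star (suc _) refl = refl
    n≢0 : n ≢ 0
    n≢0 n≡0 = no-position f (cong (_* 4) n≡0)
    -- The last division vertex has position 4n - 1; its mark has rank 2n > n and is therefore ♯.
    odds≰n : ¬ odds (suc (toℕ f)) ≤ n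
    odds≰n le = n≢0 (n≤0⇒n≡0 (+-cancelˡ-≤ n n 0 (≤-trans (≤-reflexive (sym (trans (cong odds q) (odds-4* n))))
      (≤-trans le (≤-reflexive (sym (+-identityʳ n)))))))
    sharp′ : ∀ {j} (b : Bool) (dec : Dec (odds (suc (toℕ f)) ≤ n)) {x : Fin 6} →
      (if b then halfMark dec else letter x) ≡ inj₂ j → j ≡ 1F
    sharp′ true (yes le) eq   = contradiction le odds≰n
    sharp′ true (no _)   refl = refl
    sharp : _ ≡ 1F
    sharp = sharp′ (odd? (toℕ f)) (odds (suc (toℕ f)) ≤? n) cu

  letters-constant⇒mark : ∀ {u v} → u ↦ v → X v ≡ X u → ∃ λ k → colour v ≡ inj₂ k
  letters-constant⇒mark {u} {v} a Xv≡Xu = go (colour v) refl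
    where
    go : ∀ κ → colour v ≡ κ → ∃ λ k → κ ≡ inj₂ k
    go (inj₂ k)   _  = k , refl
    go (letter x) eq = contradiction (sym (+-cancelˡ-≡ (X u) 0 1 (trans (+-identityʳ _) (trans (sym Xv≡Xu)
      (trans (IsPotential.step X-potential a) (cong (λ κ → X u + isLetter κ) eq)))))) λ ()

  private
    X-mono : ∀ {u v} → u ⊑ v → X u ≤ X v
    X-mono = IsPotential.mono X-potential

  -- Adjacent vertices without letters are coloured ♯ and then ⋆, so v would have to be both ⋆ and
  -- ♯.
  no-three-marks : ∀ {u v w t j} → colour u ≡ inj₂ j → u ↦ v → v ↦ w → w ⊑ t → X t ≡ X u → ⊥
  no-three-marks {u} {v} {w} {t} cu a b w⊑t Xt≡Xu =
    let _ , cv = letters-constant⇒mark a (trans Xv≡Xt Xt≡Xu)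
        _ , cw = letters-constant⇒mark b (trans (≤-antisym (X-mono w⊑t) (≤-trans (≤-reflexive Xt≡Xu) (X-mono (a ◅ b ◅ ε)))) (sym Xv≡Xt))
    in contradiction (trans (sym (proj₂ (marks-adjacent a cu cv))) (proj₁ (marks-adjacent b cv cw))) λ ()
    where
    Xv≡Xt : X v ≡ X t
    Xv≡Xt = ≤-antisym (X-mono (b ◅ w⊑t)) (≤-trans (≤-reflexive Xt≡Xu) (X-mono (a ◅ ε)))

  private
    beyond-middle : ∀ {e m t} → e + t ≡ 2 * m → e < m → m < t
    beyond-middle {e} {m} {t} eq e<m = +-cancelˡ-< e m t (begin-strict
      e + m      <⟨ +-monoˡ-< m e<m ⟩
      m + m      ≡⟨ cong (m +_) (+-identityʳ m) ⟨
      2 * m      ≡⟨ eq ⟨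
      e + t      ∎)
      where open ≤-Reasoning

  no-vertical : ∀ {z m t} → Halved z z m t → ⊥
  no-vertical {z} {m} {t} H = go (colour z) refl
    where
    open Halved H
    m↦c = proj₁ (proj₂ below)
    balance : ∀ {f N κ} → IsPotential f N → colour z ≡ κ → 2 * N m + f κ ≡ N t + N z
    balance {f} {N} pot refl = +-cancelˡ-≡ (N z) _ _ (trans (sym (+-assoc (N z) _ _)) (trans (halves pot) (regroup (N t) (N z))))
      where
      regroup : ∀ a b → a + 2 * b ≡ b + (a + b)
      regroup = solve-∀
    two-marks : ∀ {k} → colour z ≡ inj₂ k → z ⊑ m → m ↦ proj₁ below → proj₁ below ⊑ t → X t ≡ X z → ⊥
    two-marks cz (a ◅ ε)       b  c⊑t       Xt≡ = no-three-marks cz a b c⊑t Xt≡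
    two-marks cz (a ◅ a′ ◅ as) b  c⊑t       Xt≡ = no-three-marks cz a a′ (as ◅◅ (b ◅ c⊑t)) Xt≡
    two-marks cz ε             b  (b′ ◅ bs) Xt≡ = no-three-marks cz b b′ bs Xt≡
    -- The path is just ♯ followed by ⋆, and counting ♯ separates its halves.
    two-marks {k} cz ε         b  ε         Xt≡ =
      let _ , ct = letters-constant⇒mark b Xt≡
          z♯ , t⋆ = marks-adjacent b cz ct
          balanced = trans (balance B-potential (trans cz (cong inj₂ z♯)))
            (cong (_+ B z) (trans (IsPotential.step B-potential b) (cong (λ κ → B z + isSharp κ) (trans ct (cong inj₂ t⋆)))))
      in contradiction (+-cancelˡ-≡ (2 * B z) 1 0 (trans balanced (regroup (B z)))) λ ()
      where
      regroup : ∀ b → b + 0 + b ≡ 2 * b + 0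
      regroup = solve-∀
    go : ∀ κ → colour z ≡ κ → ⊥
    -- The letter of z belongs to the first half, whose letters therefore start at position e, one
    -- less than `X z`.
    go (letter x) cz = unbalanced e<Xm (beyond-middle lengths e<Xm) (lengths , counts)
      where
      e = proj₁ (letter-index z cz)
      Xz≡ = proj₁ (proj₂ (letter-index z cz))
      x≡ = proj₂ (proj₂ (letter-index z cz))
      e<Xm : e < X m
      e<Xm = ≤-trans (≤-reflexive (sym Xz≡)) (X-mono z⊑m)
      lengths : e + X t ≡ 2 * X m
      lengths = +-cancelˡ-≡ 1 _ _ (trans (+-comm (suc e) (X t)) (trans (cong (X t +_) (sym Xz≡))
        (trans (sym (balance X-potential cz)) (+-comm _ 1))))
      counts : ∀ c → occ c e + occ c (X t) ≡ 2 * occ c (X m)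
      counts c = +-cancelʳ-≡ (δ x c) _ _ (begin
        occ c e + occ c (X t) + δ x c            ≡⟨ regroup (occ c e) (occ c (X t)) (δ x c) ⟩
        occ c (X t) + (occ c e + δ x c)          ≡⟨ cong (λ y → occ c (X t) + (occ c e + δ y c)) x≡ ⟩
        occ c (X t) + occ c (suc e)              ≡⟨ cong (λ y → occ c (X t) + occ c y) Xz≡ ⟨
        occ c (X t) + occ c (X z)                ≡⟨ balance (occ-potential c) cz ⟨
        2 * occ c (X m) + δ x c                ∎)
        where
        open ≡-Reasoning
        regroup : ∀ a b c → a + b + c ≡ b + (a + c)
        regroup = solve-∀
    go (inj₂ k) cz with m≤n⇒m<n∨m≡n (X-mono z⊑m)
    ... | inj₁ Xz<Xm = unbalanced Xz<Xm (beyond-middle (shift X-potential refl) Xz<Xm)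
                         (shift X-potential refl , λ c → shift (occ-potential c) refl)
      where
      shift : ∀ {f N} → IsPotential f N → f (inj₂ k) ≡ 0 → N z + N t ≡ 2 * N m
      shift {f} {N} pot f≡0 = trans (+-comm (N z) (N t)) (trans (sym (balance pot cz)) (trans (cong (2 * N m +_) f≡0) (+-identityʳ _)))
    ... | inj₂ Xz≡Xm = two-marks cz z⊑m m↦c (proj₂ (proj₂ below))
      (+-cancelʳ-≡ (X z) _ _ (trans (sym (balance X-potential cz)) (trans (+-identityʳ _)
        (trans (cong (2 *_) (sym Xz≡Xm)) (cong (X z +_) (+-identityʳ _))))))


  -- Paths with two legs

  address : V S → List (Fin d)
  address (inj₁ (l , _))             = l
  -- A division vertex gets the address of the lower end of its edge, so a branch includes the edge
  -- leading into it.
  address (inj₂ (((l , _) , i) , _)) = i ∷ l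

  above-++ : ∀ w l → above l ≤ above (w ++ l)
  above-++ []      l = ≤-refl
  above-++ (i ∷ w) l = ≤-trans (above-++ w l) (m≤m+n _ _)

  size-≤ : ∀ l i → size l i ≤ d * unit (h ∸ suc (length l))
  size-≤ l i = *-monoˡ-≤ (unit (h ∸ suc (length l))) (toℕ<n i)

  -- An upper bound for the marks above any descendant, decreasing along the tree.
  ceiling : List (Fin d) → ℕ
  ceiling l = above l + suc d ^ (h ∸ suc (length l))

  -- A parameter is at most d units, and since d (d+1)^r + (d+1)^r = (d+1)^(r+1), one unit remains
  -- for everything further down.
  ceiling-∷ : ∀ i l → ceiling (i ∷ l) ≤ ceiling l
  ceiling-∷ i l = begin
    above l + size l i + suc d ^ (h ∸ suc (suc (length l)))    ≡⟨ cong (λ r → above l + size l i + suc d ^ r) (pred[m∸n]≡m∸[1+n] h (suc (length l))) ⟨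
    above l + size l i + suc d ^ pred r                        ≤⟨ +-monoˡ-≤ _ (+-monoʳ-≤ (above l) (size-≤ l i)) ⟩
    above l + d * unit r + suc d ^ pred r                      ≡⟨ +-assoc (above l) _ _ ⟩
    above l + (d * unit r + suc d ^ pred r)                    ≤⟨ +-monoʳ-≤ (above l) (capacity r) ⟩
    above l + suc d ^ r                                        ∎
    where
    open ≤-Reasoning
    r = h ∸ suc (length l)
    capacity : ∀ r → d * unit r + suc d ^ pred r ≤ suc d ^ r
    capacity zero    = ≤-reflexive (cong (_+ 1) (*-zeroʳ d))
    capacity (suc r) = ≤-reflexive (+-comm (d * suc d ^ r) (suc d ^ r))

  ceiling-++ : ∀ w l → ceiling (w ++ l) ≤ ceiling l
  ceiling-++ []      l = ≤-refl
  ceiling-++ (i ∷ w) l = ≤-trans (ceiling-∷ i (w ++ l)) (ceiling-++ w l)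

  marks-≤ : ∀ v → A v ≤ above (address v) × B v ≤ above (address v)
  marks-≤ (inj₁ (l , _)) with h ∸ length l
  ... | zero  = ≤-refl , ≤-refl
  ... | suc _ = ≤-refl , ≤-refl
  marks-≤ (inj₂ (((l , _) , i) , f)) =
      +-monoʳ-≤ (above l) (m⊓n≤n _ (size l i))
    , +-monoʳ-≤ (above l) (≤-trans (∸-monoˡ-≤ (size l i) (odds-mono (≤⇒≤′ (toℕ<n f))))
        (≤-reflexive (trans (cong (_∸ size l i) (odds-4* (size l i))) (m+n∸n≡m (size l i) (size l i)))))

  ≤-marks : ∀ v {j l} → address v ≡ j ∷ l → above l ≤ A v × above l ≤ B v
  ≤-marks (inj₁ (_ , _)) {j} {l} refl with h ∸ suc (length l)
  ... | zero  = m≤m+n _ _ , m≤m+n _ _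
  ... | suc _ = m≤m+n _ _ , m≤m+n _ _
  ≤-marks (inj₂ _) refl = m≤m+n _ _ , m≤m+n _ _

  InBranch : List (Fin d) → Fin d → V S → Set
  InBranch l i v = ∃ λ w → address v ≡ w ++ i ∷ l

  inBranch-step : ∀ {l i u v} → u ↦ v → InBranch l i u → InBranch l i v
  inBranch-step (direct (_ , j) _)     (w , eq) = j ∷ w , cong (j ∷_) eq
  inBranch-step (first (_ , j) _ _)    (w , eq) = j ∷ w , cong (j ∷_) eq
  inBranch-step (middle _ _ _ _)       (w , eq) = w , eq
  inBranch-step (last _ _ _)           (w , eq) = w , eq

  inBranch-⊑ : ∀ {l i u v} → u ⊑ v → InBranch l i u → InBranch l i v
  inBranch-⊑ ε        b = b
  inBranch-⊑ (a ◅ as) b = inBranch-⊑ as (inBranch-step a b)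

  starts-inBranch : ∀ {l p i x} → Starts {T} {subdivide} ((l , p) , i) x → InBranch l i x
  starts-inBranch (direct _)  = [] , refl
  starts-inBranch (first _ _) = [] , refl

  module Branch {l i v} (inBranch : InBranch l i v) where

    upper : ∀ {r} → h ∸ suc (length l) ≡ suc r →
      A v < above l + size l i + suc d ^ r × B v < above l + size l i + suc d ^ r
    upper {r} eq = bound (proj₁ (marks-≤ v)) , bound (proj₂ (marks-≤ v))
      where
      bound : ∀ {x} → x ≤ above (address v) → x < above l + size l i + suc d ^ r
      bound {x} x≤ = begin-strict
        x                                                         ≤⟨ x≤ ⟩
        above (address v)                                         <⟨ m<m+n (above (address v)) (m^n>0 (suc d) (h ∸ suc (length (address v)))) ⟩
        ceiling (address v)                                       ≡⟨ cong ceiling (proj₂ inBranch) ⟩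
        ceiling (proj₁ inBranch ++ i ∷ l)                         ≤⟨ ceiling-++ (proj₁ inBranch) (i ∷ l) ⟩
        above l + size l i + suc d ^ (h ∸ suc (suc (length l)))   ≡⟨ cong (λ e → above l + size l i + suc d ^ e) (trans (sym (pred[m∸n]≡m∸[1+n] h (suc (length l)))) (cong pred eq)) ⟩
        above l + size l i + suc d ^ r                            ∎
        where open ≤-Reasoning

    lower : ∀ {j w} → address v ≡ j ∷ w ++ i ∷ l → above l + size l i ≤ A v × above l + size l i ≤ B v
    lower {j} {w} eq = let a , b = ≤-marks v eq in ≤-trans (above-++ w (i ∷ l)) a , ≤-trans (above-++ w (i ∷ l)) b

  outer-marks : ∀ r l → flats (outerState r l) ≡ above l × sharps (outerState r l) ≡ above l
  outer-marks zero    l = refl , refl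
  outer-marks (suc r) l = refl , refl

  -- On every edge all ♭ precede all ♯.
  flats-first : ∀ v {l i} → InBranch l i v → B v ≡ above l ⊎ above l + size l i ≤ A v
  flats-first v b@(j ∷ w , eq) = inj₂ (proj₁ (Branch.lower {v = v} b eq))
  flats-first (inj₁ (_ , _)) {l} {i} ([] , refl) =
    inj₂ (≤-reflexive (sym (proj₁ (outer-marks (h ∸ suc (length l)) (i ∷ l)))))
  flats-first (inj₂ (((l , _) , i) , f)) ([] , refl) with ≤-total (odds (suc (toℕ f))) (size l i)
  ... | inj₁ o≤n = inj₁ (trans (cong (above l +_) (m≤n⇒m∸n≡0 o≤n)) (+-identityʳ _))
  ... | inj₂ n≤o = inj₂ (≤-reflexive (cong (above l +_) (sym (m≥n⇒m⊓n≡n n≤o))))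

  length-address : ∀ v → length (address v) ≤ h
  length-address (inj₁ (_ , p))             = p
  length-address (inj₂ (((_ , p) , _) , _)) = p

  -- The first ⋆ below the apex can only be at the lower end of the branch's first edge, after all
  -- its ♯; past that edge, its lower end is internal.
  sharps-before-star : ∀ v {l i} → InBranch l i v → Z v ≡ suc (length l) ⊎
    (∃ λ r → h ∸ suc (length l) ≡ suc r) × above l + size l i ≤ B v
  sharps-before-star v {l} {i} b@(j ∷ w , eq) = inj₂ (positive , proj₂ (Branch.lower {v = v} b eq))
    where
    inside : suc (length l) < h
    inside = begin-strict
      suc (length l)              ≤⟨ m≤n+m _ (length w) ⟩
      length w + suc (length l)   ≡⟨ length-++ w ⟨
      length (w ++ i ∷ l)         <⟨ n<1+n _ ⟩
      length (j ∷ w ++ i ∷ l)     ≡⟨ cong length eq ⟨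
      length (address v)          ≤⟨ length-address v ⟩
      h                           ∎
      where open ≤-Reasoning
    positive : ∃ λ r → h ∸ suc (length l) ≡ suc r
    positive with h ∸ suc (length l) | m<n⇒0<n∸m inside
    ... | suc r | _ = r , refl
  sharps-before-star (inj₁ (_ , _)) {l} {i} ([] , refl) = go (h ∸ suc (length l)) refl
    where
    go : ∀ r → h ∸ suc (length l) ≡ r → stars (outerState r (i ∷ l)) ≡ suc (length l) ⊎
      (∃ λ r → h ∸ suc (length l) ≡ suc r) × above (i ∷ l) ≤ sharps (outerState (h ∸ suc (length l)) (i ∷ l))
    go zero    _  = inj₁ refl
    go (suc r) eq = inj₂ ((r , eq) , ≤-reflexive (sym (proj₂ (outer-marks (h ∸ suc (length l)) (i ∷ l)))))
  sharps-before-star (inj₂ _) ([] , refl) = inj₁ refl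

  private
    -- Distinct multiples of u differ by at least u.
    unit-gap : ∀ {i j : Fin d} u → suc (toℕ i) * u < suc (toℕ j) * u + u → i ≢ j →
      suc (toℕ i) * u + u ≤ suc (toℕ j) * u
    unit-gap {i} {j} u lt i≢j = begin
      suc (toℕ i) * u + u       ≡⟨ +-comm (suc (toℕ i) * u) u ⟩
      suc (suc (toℕ i)) * u     ≤⟨ *-monoˡ-≤ u (s≤s (≤∧≢⇒< i≤j (λ e → i≢j (toℕ-injective e)))) ⟩
      suc (toℕ j) * u           ∎
      where
      open ≤-Reasoning
      i≤j : toℕ i ≤ toℕ j
      i≤j = ≤-pred (≤-pred (*-cancelʳ-< u (suc (toℕ i)) (suc (suc (toℕ j)))
        (<-≤-trans lt (≤-reflexive (+-comm (suc (toℕ j) * u) u)))))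

  -- n and n′ are the parameters of the edges below the apex towards y and t,
  -- and a is the number of ♭, and of ♯, above the apex.
  fork-counts : ∀ {a n n′ u yA yB mA mB tA tB} → 1 ≤ u → u ≤ n′ →
    (n < n′ + u → n + u ≤ n′) →
    yA + 2 * mA + 0 ≡ tA + 2 * a → yB + 2 * mB + 0 ≡ tB + 2 * a →
    a ≤ yA → a ≤ mA → yB < a + n + u → tA < a + n′ + u → a + n′ ≤ tB →
    yB ≡ a ⊎ a + n ≤ yA → mB ≡ a ⊎ a + n′ ≤ mA → ⊥
  fork-counts {a} {n} {n′} {u} {yA} {yB} {mA} {mB} {tA} {tB} 1≤u u≤n′ gap eqA eqB a≤yA a≤mA yB< tA< ≤tB = go
    where
    open ≤-Reasoning
    go : yB ≡ a ⊎ a + n ≤ yA → mB ≡ a ⊎ a + n′ ≤ mA → ⊥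
    -- If m has passed all n′ marks ♭ of its edge, the leg to t needs at least 2n′ of them but has
    -- fewer than n′ + u.
    go _ (inj₂ ≤mA) = <-irrefl refl (begin-strict
      yA + 2 * mA + 0         ≡⟨ eqA ⟩
      tA + 2 * a              <⟨ +-monoˡ-< (2 * a) tA< ⟩
      a + n′ + u + 2 * a      ≤⟨ +-monoˡ-≤ (2 * a) (+-monoʳ-≤ (a + n′) u≤n′) ⟩
      a + n′ + n′ + 2 * a     ≡⟨ regroup a n′ ⟩
      a + 2 * (a + n′) + 0    ≤⟨ +-monoˡ-≤ 0 (+-mono-≤ a≤yA (*-monoʳ-≤ 2 ≤mA)) ⟩
      yA + 2 * mA + 0         ∎)
      where
      regroup : ∀ a n → a + n + n + 2 * a ≡ a + 2 * (a + n) + 0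
      regroup = solve-∀
    go y (inj₁ refl) = case y
      where
      yB≡tB : yB ≡ tB
      yB≡tB = +-cancelʳ-≡ (2 * a) yB tB (trans (sym (+-identityʳ _)) eqB)
      yA≤tA : yA ≤ tA
      yA≤tA = +-cancelʳ-≤ (2 * a) yA tA (begin
        yA + 2 * a         ≤⟨ +-monoʳ-≤ yA (*-monoʳ-≤ 2 a≤mA) ⟩
        yA + 2 * mA        ≡⟨ +-identityʳ _ ⟨
        yA + 2 * mA + 0    ≡⟨ eqA ⟩
        tA + 2 * a         ∎)
      case : yB ≡ a ⊎ a + n ≤ yA → ⊥
      -- The leg to y has no ♯ at all, yet must match the n′ or more below m.
      case (inj₁ yB≡a) = <-irrefl refl (begin-strict
        a          <⟨ m<m+n a (≤-trans 1≤u u≤n′) ⟩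
        a + n′     ≤⟨ ≤tB ⟩
        tB         ≡⟨ yB≡tB ⟨
        yB         ≡⟨ yB≡a ⟩
        a          ∎)
      -- Counting ♭ gives n < n′ + u, hence n + u ≤ n′; but the leg to y has fewer than n + u marks
      -- ♯ and needs n′.
      case (inj₂ ≤yA) = <-irrefl refl (begin-strict
        yB             <⟨ yB< ⟩
        a + n + u      ≡⟨ +-assoc a n u ⟩
        a + (n + u)    ≤⟨ +-monoʳ-≤ a (gap (+-cancelˡ-< a n (n′ + u) (begin-strict
          a + n            ≤⟨ ≤yA ⟩
          yA               ≤⟨ yA≤tA ⟩
          tA               <⟨ tA< ⟩
          a + n′ + u       ≡⟨ +-assoc a n′ u ⟩
          a + (n′ + u)     ∎))) ⟩
        a + n′         ≤⟨ ≤tB ⟩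
        tB             ≡⟨ yB≡tB ⟨
        yB             ∎)

  module Fork-impossible {y z m t} (H : Halved y z m t) (fork : Fork y z m t)
    {l i j} (p : length l < h) (z≡ : z ≡ inj₁ (l , <⇒≤ p))
    (i≢j : i ≢ j) (left∈ : InBranch l i (Fork.left fork)) (right∈ : InBranch l j (Fork.right fork)) where

    open Halved H
    open Fork fork

    z-colour : colour z ≡ ⋆
    z-colour rewrite z≡ with h ∸ length l | m<n⇒0<n∸m p
    ... | suc _ | _ = refl

    z-state : state z ≡ ⟨ 2 * above l , above l , above l , suc (length l) ⟩
    z-state rewrite z≡ with h ∸ length l | m<n⇒0<n∸m p
    ... | suc _ | _ = refl

    y∈ : InBranch l i y
    y∈ = inBranch-⊑ left⊑y left∈

    t∈ : InBranch l j t
    t∈ = inBranch-⊑ right⊑t right∈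

    z⊑y : z ⊑ y
    z⊑y = z↦left ◅ left⊑y

    balance : ∀ (π : State → ℕ) {f} → IsPotential f (λ v → π (state v)) →
      π (state y) + 2 * π (state m) + f ⋆ ≡ π (state t) + 2 * π ⟨ 2 * above l , above l , above l , suc (length l) ⟩
    balance π {f} pot = subst₂ (λ c σ → π (state y) + 2 * π (state m) + f c ≡ π (state t) + 2 * π σ) z-colour z-state (halves pot)

    above-z : ∀ (π : State → ℕ) {f v} → IsPotential f (λ v → π (state v)) → z ⊑ v →
      π ⟨ 2 * above l , above l , above l , suc (length l) ⟩ ≤ π (state v)
    above-z π {v = v} pot z⊑v = subst (λ σ → π σ ≤ π (state v)) z-state (IsPotential.mono pot z⊑v)

    m-flats : B m ≡ above l ⊎ above l + size l j ≤ A m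
    m-flats with position
    ... | inj₁ refl    = inj₁ (cong sharps z-state)
    ... | inj₂ right⊑m = flats-first m (inBranch-⊑ right⊑m right∈)

    impossible : ⊥
    impossible with sharps-before-star t t∈
    -- With no ⋆ on the leg to t, the ⋆ of the apex has no counterpart in the other half.
    ... | inj₁ Zt≡ = <-irrefl refl (begin-strict
      suc k + 2 * suc k             ≤⟨ +-mono-≤ (above-z stars Z-potential z⊑y) (*-monoʳ-≤ 2 (above-z stars Z-potential z⊑m)) ⟩
      Z y + 2 * Z m                 <⟨ m<m+n _ z<s ⟩
      Z y + 2 * Z m + 1             ≡⟨ balance stars Z-potential ⟩
      Z t + 2 * suc k               ≡⟨ cong (_+ 2 * suc k) Zt≡ ⟩
      suc k + 2 * suc k             ∎)
      where
      open ≤-Reasoning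
      k = length l
    ... | inj₂ ((r , eq) , ≤Bt) = fork-counts (m^n>0 (suc d) r) (u≤size eq) gap
        (balance flats A-potential) (balance sharps B-potential)
        (above-z flats A-potential z⊑y) (above-z flats A-potential z⊑m)
        (proj₂ (Branch.upper {v = y} y∈ eq)) (proj₁ (Branch.upper {v = t} t∈ eq)) ≤Bt
        (flats-first y y∈) m-flats
      where
      u≤size : h ∸ suc (length l) ≡ suc r → suc d ^ r ≤ size l j
      u≤size eq rewrite eq = m≤m+n _ _
      gap : size l i < size l j + suc d ^ r → size l i + suc d ^ r ≤ size l j
      gap lt rewrite eq = unit-gap {i} {j} (suc d ^ r) lt i≢j

  no-fork : ∀ {y z m t} → Halved y z m t → Fork y z m t → ⊥
  no-fork {z = z} H fork =
    let (e , e′ , z≡ , z≡′ , start , start′) = branching z↦left z↦right left≢right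
    in go e e′ z≡ (cong address (trans (sym z≡) z≡′)) start start′
    where
    open Fork fork
    go : ∀ e e′ → z ≡ inj₁ (src T e) → proj₁ (proj₁ e) ≡ proj₁ (proj₁ e′) →
      Starts e left → Starts e′ right → ⊥
    go ((l , p) , i) ((l , q) , j) z≡ refl start start′ with refl ← ≤-irrelevant p q =
      Fork-impossible.impossible H fork p z≡
        (λ { refl → left≢right (starts-unique start start′) }) (starts-inBranch start) (starts-inBranch start′)

  anagram-free : AnagramFree S colour
  anagram-free p path anagram with anagram⇒halved p path anagram
  ... | y , z , m , t , H with Halved.shape H
  ...   | inj₁ refl = no-vertical H
  ...   | inj₂ fork = no-fork H fork

  -- The number of division vertices per edge

  subdivide-≤ : ∀ e → subdivide e ≤ 2 * d * (d + 1) ^ (h ∸ 1)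
  subdivide-≤ ((l , _) , i) = begin
    size l i * 4                 ≤⟨ *-monoˡ-≤ 4 (size-≤ l i) ⟩
    d * unit r * 4               ≡⟨ regroup d (unit r) ⟩
    2 * d * (unit r * 2)         ≤⟨ *-monoʳ-≤ (2 * d) (double-unit r) ⟩
    2 * d * suc d ^ r            ≤⟨ *-monoʳ-≤ (2 * d) (^-monoʳ-≤ (suc d) (∸-monoʳ-≤ h (s≤s z≤n))) ⟩
    2 * d * suc d ^ (h ∸ 1)      ≡⟨ cong (λ b → 2 * d * b ^ (h ∸ 1)) (+-comm 1 d) ⟩
    2 * d * (d + 1) ^ (h ∸ 1)    ∎
    where
    open ≤-Reasoning
    r = h ∸ suc (length l)
    regroup : ∀ d u → d * u * 4 ≡ 2 * d * (u * 2)
    regroup = solve-∀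
    double-unit : ∀ r → unit r * 2 ≤ suc d ^ r
    double-unit zero    = z≤n
    -- The existence of `i : Fin d` gives 2 ≤ d + 1, which absorbs the factor 2.
    double-unit (suc r) = ≤-trans (≤-reflexive (*-comm (suc d ^ r) 2))
      (*-monoˡ-≤ (suc d ^ r) (s≤s (≤-trans (s≤s z≤n) (toℕ<n i))))

theorem10 : (d h : ℕ) → 1 ≤ d → 1 ≤ h →
    Σ (Edge (CompleteTree d h) → ℕ) λ s →
    (∀ e → s e ≤ 2 * d * (d + 1) ^ (h ∸ 1)) ×
    φ≤ (Subdivision (CompleteTree d h) s) 10
theorem10 d h _ _ = subdivide d h , subdivide-≤ d h ,
  (λ v → Fin.join 6 4 (colour d h v)) ,
  λ p path anagram → anagram-free d h p path (subst IsAnagram (decode p) (anagram-map (Fin.splitAt 6) anagram))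
  where
  decode : ∀ p → map (Fin.splitAt 6) (map (λ v → Fin.join 6 4 (colour d h v)) p) ≡ map (colour d h) p
  decode p = trans (sym (map-∘ p)) (map-cong (λ v → Fin.splitAt-join 6 4 (colour d h v)) p)
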